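{- Let $f(x)=ax^2+bx+c$ be a primitive quadratic polynomial with integer coefficients, $a\ge1$, and discriminant $D=b^2-4ac$. Let $k$ be a positive integer. The function $g_{k,f}$ is eventually periodic if and only if $D\ne a^2i^2$ for all integers $i$ with $1\le i\le k$. Furthermore, if $g_{k,f}$ is eventually periodic, then $B_k=\mathrm{lcm}_{1\le i\le k}\{i(a^2i^2-D)\}$ is a period of it.
   Context: Primitive means $\gcd(a,b,c)=1$. $\mathbb{N}^*$ is the set of positive integers. Let $Z_{k,f}=\bigcup_{i=0}^k\{n\in\mathbb{N}^*: f(n+i)=0\}$ (a finite set). For $n\in\mathbb{N}^*\setminus Z_{k,f}$ define $g_{k,f}(n)=\frac{\prod_{i=0}^k|f(n+i)|}{\mathrm{lcm}_{0\le i\le k}\{f(n+i)\}}$. All lcm's are taken positive. The function $g_{k,f}$ is eventually periodic if there are positive integers $t$ and $n_0$ such that $g_{k,f}(n+t)=g_{k,f}(n)$ for all integers $n\ge n_0$; such a $t$ is called a period of $g_{k,f}$. -}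

module Defs where

open import Data.Integer.Base as ℤ using (ℤ; +_; ∣_∣; 0ℤ; 1ℤ)
open import Data.Integer.GCD as ℤ using ()
open import Data.Integer.Properties using (∣i∣≡0⇒i≡0)
open import Data.List.Base using (List; []; _∷_; foldr; applyUpTo)
open import Data.List.Relation.Unary.All.Properties using (applyUpTo⁺₁)
open import Data.Nat.Base using (ℕ; suc; _+_; _≤_; _/_; s≤s⁻¹; NonZero; ≢-nonZero; ≢-nonZero⁻¹)
open import Data.Nat.Divisibility using (_∣_; ∣-refl; ∣-trans; m∣m*n; n∣m*n; 0∣⇒≡0)
open import Data.Nat.LCM using (lcm; lcm-least)
open import Data.Nat.ListAction using (product)
open import Data.Nat.ListAction.Properties using (product≢0)
open import Data.Product.Base using (Σ-syntax; ∃-syntax; _×_; _,_)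
open import Level using (0ℓ)
open import Relation.Binary.PropositionalEquality using (_≡_; subst)
open import Relation.Unary using (Pred; _∈_; _∉_)

quadratic : ℤ → ℤ → ℤ → ℤ → ℤ
quadratic a b c x = a ℤ.* (x ℤ.* x) ℤ.+ b ℤ.* x ℤ.+ c

Primitive : ℤ → ℤ → ℤ → Set
Primitive a b c = ℤ.gcd (ℤ.gcd a b) c ≡ 1ℤ

discriminant : ℤ → ℤ → ℤ → ℤ
discriminant a b c = b ℤ.* b ℤ.- + 4 ℤ.* a ℤ.* c

lcms : List ℕ → ℕ
lcms = foldr lcm 1

lcms∣product : ∀ ns → lcms ns ∣ product ns
lcms∣product []       = ∣-refl
lcms∣product (n ∷ ns) =
  lcm-least {n} (m∣m*n (product ns)) (∣-trans (lcms∣product ns) (n∣m*n n))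

Z : ℕ → (ℤ → ℤ) → Pred ℕ 0ℓ
Z k f n = 1 ≤ n × ∃[ i ] i ≤ k × f (+ (n + i)) ≡ 0ℤ

Domain : ℕ → (ℤ → ℤ) → Pred ℕ 0ℓ
Domain k f n = 1 ≤ n × n ∉ Z k f

-- Since lcm (i, j) = lcm (|i|, |j|) ≥ 0, only the absolute values matter.
values : ℕ → (ℤ → ℤ) → ℕ → List ℕ
values k f n = applyUpTo (λ i → ∣ f (+ (n + i)) ∣) (suc k)

lcms-values≢0 : ∀ k f n → n ∈ Domain k f → NonZero (lcms (values k f n))
lcms-values≢0 k f n (1≤n , n∉Z) = ≢-nonZero λ lcms≡0 →
  ≢-nonZero⁻¹ (product (values k f n)) {{product≢0 values≢0}}
    (0∣⇒≡0 (subst (_∣ product (values k f n)) lcms≡0 (lcms∣product (values k f n))))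
  where
  values≢0 = applyUpTo⁺₁ (λ i → ∣ f (+ (n + i)) ∣) (suc k) λ {i} i<1+k →
    ≢-nonZero λ ∣fi∣≡0 → n∉Z (1≤n , i , s≤s⁻¹ i<1+k , ∣i∣≡0⇒i≡0 ∣fi∣≡0)

-- The natural-number division is exact, by lcms∣product.
g : ∀ k f n → n ∈ Domain k f → ℕ
g k f n n∈D = product (values k f n) / lcms (values k f n)
  where instance _ = lcms-values≢0 k f n n∈D

-- g is a partial function, so the equation g (n + t) = g n includes the claim
-- that both sides are defined.
IsPeriod : ℕ → (ℤ → ℤ) → Pred ℕ 0ℓ
IsPeriod k f t = 1 ≤ t × ∃[ n₀ ] 1 ≤ n₀ × (∀ n → n₀ ≤ n →
  Σ[ n∈D ∈ n ∈ Domain k f ] Σ[ n+t∈D ∈ n + t ∈ Domain k f ]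
    g k f (n + t) n+t∈D ≡ g k f n n∈D)

EventuallyPeriodic : ℕ → (ℤ → ℤ) → Set
EventuallyPeriodic k f = ∃[ t ] IsPeriod k f t

-- lcm of the i (a² i² − D) over 1 ≤ i ≤ k, with i = suc j.
B : ℕ → ℤ → ℤ → ℕ
B k a D = lcms (applyUpTo (λ j → term (+ suc j)) k)
  where
  term : ℤ → ℕ
  term i = ∣ i ℤ.* (a ℤ.* a ℤ.* (i ℤ.* i) ℤ.- D) ∣

{-# OPTIONS --safe #-}

-- Peeling off one value at a time, with lcm (x, L) · gcd (x, L) = x · L, writes
-- g(n) as the product over i of gcd (f(n+i), lcm_{j>i} f(n+j)), and since gcd
-- distributes over lcm, g(n) depends only on the gcd (f(n+i), f(n+j)), i < j.
-- Put u = 2am + b.  The identity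
--   d (a²d² − D) = 4ad f(m) − (u − ad) (f(m+d) − f(m))
-- shows that gcd (f(m), f(m+d)) divides B_k for 1 ≤ d ≤ k, so it only depends on
-- f(m) and f(m+d) modulo B_k: if B_k ≠ 0, then g is B_k-periodic.
-- Conversely, if D = a²i², then u + ai divides both 4a f(m) = (u − ai) (u + ai)
-- and 4a f(m+i) = (u + ai) (u + 3ai), so it divides 4a g(m), and g is unbounded.
module Submission where

open import Defs
open import Data.Integer.Base
  using (ℤ; +_; 1ℤ; 0ℤ; _*_; _+_; _-_; -_; +≤+)
  renaming (_≤_ to _≤ᶻ_; ∣_∣ to abs)
open import Data.Integer.Properties as ℤ
  using (abs-*; ∣i+j∣≤∣i∣+∣j∣; ∣i-j∣≤∣i∣+∣j∣; ∣i∣≡0⇒i≡0; i-j≡0⇒i≡j; ∣-i∣≡∣i∣)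
open import Data.Integer.Divisibility.Signed as ℤ using (∣ᵤ⇒∣; ∣⇒∣ᵤ)
open import Data.Integer.Tactic.RingSolver using (solve-∀)
open import Data.List.Base using (List; []; _∷_; applyUpTo)
open import Data.List.Membership.Propositional using () renaming (_∈_ to _∈ˡ_)
open import Data.List.Membership.Propositional.Properties using (∈-applyUpTo⁺)
open import Data.List.Relation.Binary.Pointwise using (Pointwise; []; _∷_)
open import Data.List.Relation.Unary.All using (All; []; _∷_)
open import Data.List.Relation.Unary.All.Properties using (applyUpTo⁺₁)
open import Data.List.Relation.Unary.AllPairs using (AllPairs; []; _∷_)
open import Data.List.Relation.Unary.AllPairs.Properties renaming (applyUpTo⁺₁ to AllPairs-applyUpTo⁺)
open import Data.List.Relation.Unary.Any using (here; there)
open import Data.Nat.Base as ℕ using (ℕ; _≤_; _<_; zero; suc; NonZero; ≢-nonZero; s≤s; z≤n)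
open import Data.Nat.Divisibility
  using (_∣_; _∣0; ∣-refl; ∣-trans; ∣-antisym; ∣⇒≤; 0∣⇒≡0; ∣m⇒∣m*n; *-monoʳ-∣;
         *-pres-∣; *-cancelʳ-∣)
open import Data.Nat.DivMod using (m*n/n≡m)
open import Data.Nat.GCD
  using (gcd; gcd[m,n]∣m; gcd[m,n]∣n; gcd-greatest; gcd-zeroʳ; gcd-identityˡ;
         gcd[m,n]≡0⇒m≡0; c*gcd[m,n]≡gcd[cm,cn])
open import Data.Nat.LCM using (lcm; m∣lcm[m,n]; n∣lcm[m,n]; lcm-least; gcd*lcm)
open import Data.Nat.ListAction using (product)
open import Data.Nat.ListAction.Properties using (product≢0)
import Data.Nat.Properties as ℕ
import Data.Nat.Tactic.RingSolver as ℕ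
open import Data.Product.Base using (_×_; _,_; proj₁)
open import Function.Base using (_∘_)
open import Function.Bundles using (_⇔_; mk⇔)
open import Relation.Binary.PropositionalEquality
  using (_≡_; _≢_; refl; sym; trans; cong; cong₂; subst; subst₂; module ≡-Reasoning)
open import Relation.Nullary.Negation using (contradiction)
open import Relation.Unary using (_∈_)

-- gcd distributes over lcm

gcd-mono-∣ : ∀ m n {m′ n′} → m ∣ m′ → n ∣ n′ → gcd m n ∣ gcd m′ n′
gcd-mono-∣ m n m∣m′ n∣n′ =
  gcd-greatest (∣-trans (gcd[m,n]∣m m n) m∣m′) (∣-trans (gcd[m,n]∣n m n) n∣n′)

lcm-mono-∣ : ∀ {m n m′ n′} → m ∣ m′ → n ∣ n′ → lcm m n ∣ lcm m′ n′
lcm-mono-∣ {m′ = m′} {n′} m∣m′ n∣n′ =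
  lcm-least (∣-trans m∣m′ (m∣lcm[m,n] m′ n′)) (∣-trans n∣n′ (n∣lcm[m,n] m′ n′))

-- With L = lcm (gcd (d, y), gcd (d, z)), L · gcd (d, y, z) = gcd (d, y) · gcd (d, z)
-- = gcd (d², dz, dy, yz), and each of the four is a multiple of d · gcd (d, y, z).
∣lcm⇒∣lcm-gcd : ∀ d y z → d ∣ lcm y z → d ∣ lcm (gcd d y) (gcd d z)
∣lcm⇒∣lcm-gcd zero y z d∣ =
  subst₂ (λ u v → 0 ∣ lcm u v) (sym (gcd-identityˡ y)) (sym (gcd-identityˡ z)) d∣
∣lcm⇒∣lcm-gcd d@(suc _) y z d∣ = *-cancelʳ-∣ h (subst (d ℕ.* h ∣_)
    (trans (sym (gcd*lcm p q)) (ℕ.*-comm h (lcm p q)))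
    (subst (d ℕ.* h ∣_) (sym (c*gcd[m,n]≡gcd[cm,cn] p d z))
      (gcd-greatest ∣pd ∣pz)))
  where
  p = gcd d y
  q = gcd d z
  h = gcd p q
  h∣p = gcd[m,n]∣m p q
  h∣q = gcd[m,n]∣n p q
  h∣y = ∣-trans h∣p (gcd[m,n]∣n d y)
  h∣z = ∣-trans h∣q (gcd[m,n]∣n d z)
  instance
    h≢0 : NonZero h
    h≢0 = ≢-nonZero λ h≡0 → ℕ.1+n≢0 (gcd[m,n]≡0⇒m≡0 {d} {y} (gcd[m,n]≡0⇒m≡0 {p} {q} h≡0))
  ∣pd : d ℕ.* h ∣ p ℕ.* d
  ∣pd = subst (_∣ p ℕ.* d) (ℕ.*-comm h d) (*-pres-∣ h∣p ∣-refl)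
  ∣yz : d ℕ.* h ∣ z ℕ.* y
  ∣yz = subst (d ℕ.* h ∣_)
    (trans (ℕ.*-comm (lcm y z) (gcd y z)) (trans (gcd*lcm y z) (ℕ.*-comm y z)))
    (*-pres-∣ d∣ (gcd-greatest h∣y h∣z))
  ∣pz : d ℕ.* h ∣ p ℕ.* z
  ∣pz = subst (d ℕ.* h ∣_)
    (trans (sym (c*gcd[m,n]≡gcd[cm,cn] z d y)) (ℕ.*-comm z p))
    (gcd-greatest (subst (_∣ z ℕ.* d) (ℕ.*-comm h d) (*-pres-∣ h∣z ∣-refl)) ∣yz)

gcd-distribˡ-lcm : ∀ x y z → gcd x (lcm y z) ≡ lcm (gcd x y) (gcd x z)
gcd-distribˡ-lcm x y z = ∣-antisym
  (∣-trans (∣lcm⇒∣lcm-gcd (gcd x (lcm y z)) y z (gcd[m,n]∣n x (lcm y z)))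
    (lcm-mono-∣ (gcd-mono-∣ _ y (gcd[m,n]∣m x (lcm y z)) ∣-refl)
                (gcd-mono-∣ _ z (gcd[m,n]∣m x (lcm y z)) ∣-refl)))
  (lcm-least {gcd x y} {gcd x z}
    (gcd-mono-∣ x y ∣-refl (m∣lcm[m,n] y z)) (gcd-mono-∣ x z ∣-refl (n∣lcm[m,n] y z)))

-- The quotient of the product of a list by its lcm

redundancy : List ℕ → ℕ
redundancy []       = 1
redundancy (x ∷ xs) = gcd x (lcms xs) ℕ.* redundancy xs

redundancy*lcms : ∀ xs → redundancy xs ℕ.* lcms xs ≡ product xs
redundancy*lcms []       = refl
redundancy*lcms (x ∷ xs) = begin
  gcd x l ℕ.* o ℕ.* lcm x l  ≡⟨ swap (gcd x l) o (lcm x l) ⟩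
  gcd x l ℕ.* lcm x l ℕ.* o  ≡⟨ cong (ℕ._* o) (gcd*lcm x l) ⟩
  x ℕ.* l ℕ.* o              ≡⟨ ℕ.*-assoc x l o ⟩
  x ℕ.* (l ℕ.* o)            ≡⟨ cong (x ℕ.*_) (trans (ℕ.*-comm l o) (redundancy*lcms xs)) ⟩
  x ℕ.* product xs           ∎
  where
  open ≡-Reasoning
  l = lcms xs
  o = redundancy xs
  swap : ∀ p q r → p ℕ.* q ℕ.* r ≡ p ℕ.* r ℕ.* q
  swap = ℕ.solve-∀

product/lcms≡redundancy : ∀ xs .{{_ : NonZero (lcms xs)}} → product xs ℕ./ lcms xs ≡ redundancy xs
product/lcms≡redundancy xs =
  trans (cong (ℕ._/ lcms xs) (sym (redundancy*lcms xs))) (m*n/n≡m (redundancy xs) (lcms xs))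

redundancy≢0 : ∀ {xs} → All NonZero xs → NonZero (redundancy xs)
redundancy≢0 {xs} xs≢0 = ℕ.m*n≢0⇒m≢0 (redundancy xs)
  {{subst NonZero (sym (redundancy*lcms xs)) (product≢0 xs≢0)}}

∈⇒∣lcms : ∀ {x xs} → x ∈ˡ xs → x ∣ lcms xs
∈⇒∣lcms {x} {_ ∷ xs} (here refl)  = m∣lcm[m,n] x (lcms xs)
∈⇒∣lcms {x} {y ∷ xs} (there x∈xs) = ∣-trans (∈⇒∣lcms x∈xs) (n∣lcm[m,n] y (lcms xs))

-- Source of the lower bound on g: `y` divides `lcms ys`, so the factor contributed by the head
-- already suffices.
gcd∣redundancy : ∀ x {y ys} → y ∈ˡ ys → gcd x y ∣ redundancy (x ∷ ys)
gcd∣redundancy x {y} {ys} y∈ys = ∣m⇒∣m*n (redundancy ys) (gcd-mono-∣ x y ∣-refl (∈⇒∣lcms y∈ys))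

-- Invariance of the quotient under `_≈[ m ]_`.

infix 4 _≈[_]_

-- Weaker than congruence modulo `m`: it retains only the common divisors with `m`, and gcds that
-- divide `m` depend on nothing more.
_≈[_]_ : ℕ → ℕ → ℕ → Set
x ≈[ m ] y = gcd x m ≡ gcd y m

-- When the gcd divides `m`, replacing `x` and `y` by their gcds with `m` loses no common divisor.
gcd-reduce : ∀ m x y → gcd x y ∣ m → gcd x y ≡ gcd (gcd x m) (gcd y m)
gcd-reduce m x y d∣m = ∣-antisym
  (gcd-greatest (gcd-greatest (gcd[m,n]∣m x y) d∣m) (gcd-greatest (gcd[m,n]∣n x y) d∣m))
  (gcd-mono-∣ _ _ (gcd[m,n]∣m x m) (gcd[m,n]∣m y m))

gcd-cong : ∀ m x x′ y y′ → x ≈[ m ] x′ → y ≈[ m ] y′ →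
           gcd x y ∣ m → gcd x′ y′ ∣ m → gcd x y ≡ gcd x′ y′
gcd-cong m x x′ y y′ x≈x′ y≈y′ d∣m d′∣m =
  trans (gcd-reduce m x y d∣m) (trans (cong₂ gcd x≈x′ y≈y′) (sym (gcd-reduce m x′ y′ d′∣m)))

-- Distributing gcd over lcm leaves only gcds of two entries, and each of these divides `m`.
gcd-lcms-cong : ∀ m x y {xs ys} → x ≈[ m ] y → Pointwise _≈[ m ]_ xs ys →
                All (λ z → gcd x z ∣ m) xs → All (λ z → gcd y z ∣ m) ys →
                gcd x (lcms xs) ≡ gcd y (lcms ys)
gcd-lcms-cong m x y _ [] [] [] = trans (gcd-zeroʳ x) (sym (gcd-zeroʳ y))
gcd-lcms-cong m x y {x′ ∷ xs} {y′ ∷ ys} x≈y (x′≈y′ ∷ xs≈ys) (d∣ ∷ ds∣) (e∣ ∷ es∣) = begin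
  gcd x (lcm x′ (lcms xs))          ≡⟨ gcd-distribˡ-lcm x x′ (lcms xs) ⟩
  lcm (gcd x x′) (gcd x (lcms xs))  ≡⟨ cong₂ lcm (gcd-cong m x y x′ y′ x≈y x′≈y′ d∣ e∣)
                                                 (gcd-lcms-cong m x y x≈y xs≈ys ds∣ es∣) ⟩
  lcm (gcd y y′) (gcd y (lcms ys))  ≡⟨ gcd-distribˡ-lcm y y′ (lcms ys) ⟨
  gcd y (lcm y′ (lcms ys))          ∎
  where open ≡-Reasoning

-- `AllPairs` follows the recursion of `redundancy`: each head meets exactly the entries after it.
redundancy-cong : ∀ m {xs ys} → Pointwise _≈[ m ]_ xs ys →
                  AllPairs (λ x y → gcd x y ∣ m) xs → AllPairs (λ x y → gcd x y ∣ m) ys →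
                  redundancy xs ≡ redundancy ys
redundancy-cong m []                               []         []         = refl
redundancy-cong m (_∷_ {x = x} {y = y} x≈y xs≈ys) (d∣ ∷ ds∣) (e∣ ∷ es∣) =
  cong₂ ℕ._*_ (gcd-lcms-cong m x y x≈y xs≈ys d∣ e∣) (redundancy-cong m xs≈ys ds∣ es∣)

Pointwise-applyUpTo⁺ : ∀ {R : ℕ → ℕ → Set} f h n → (∀ i → R (f i) (h i)) →
                       Pointwise R (applyUpTo f n) (applyUpTo h n)
Pointwise-applyUpTo⁺ f h zero    Rfh = []
Pointwise-applyUpTo⁺ f h (suc n) Rfh =
  Rfh 0 ∷ Pointwise-applyUpTo⁺ (f ∘ suc) (h ∘ suc) n (Rfh ∘ suc)

-- Values of a quadratic polynomial

-- Passes from absolute values to integers and back; `r` enters through an equation so that a ring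
-- identity can be supplied directly.
∣-combination : ∀ {d r} p q s t → d ∣ abs p → d ∣ abs q → r ≡ s * p + t * q → d ∣ abs r
∣-combination {d} p q s t d∣p d∣q refl =
  ∣⇒∣ᵤ {+ d} (ℤ.∣m∣n⇒∣m+n (ℤ.∣n⇒∣m*n s (∣ᵤ⇒∣ {+ d} {p} d∣p)) (ℤ.∣n⇒∣m*n t (∣ᵤ⇒∣ {+ d} {q} d∣q)))

module _ (a b c : ℤ) where

  private
    f = quadratic a b c
    D = discriminant a b c

  -- With u = 2am + b, one has 4a f(m) = u² - D and f(m+d) - f(m) = d (u + ad); eliminating u²
  -- leaves d (a²d² - D). The full resultant of f(x) and f(x+d) is a²d² (a²d² - D).
  gcd-values∣resultant : ∀ m d → gcd (abs (f m)) (abs (f (m + d))) ∣ abs (d * (a * a * (d * d) - D))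
  gcd-values∣resultant m d =
    ∣-combination (f m) (f (m + d)) (+ 4 * a * d + (u - a * d)) (a * d - u)
      (gcd[m,n]∣m (abs (f m)) (abs (f (m + d)))) (gcd[m,n]∣n (abs (f m)) (abs (f (m + d)))) (identity a b c m d)
    where
    u = + 2 * a * m + b
    identity : ∀ a b c m d →
      d * (a * a * (d * d) - (b * b - + 4 * a * c)) ≡
        (+ 4 * a * d + (+ 2 * a * m + b - a * d)) * (a * (m * m) + b * m + c)
        + (a * d - (+ 2 * a * m + b)) * (a * ((m + d) * (m + d)) + b * (m + d) + c)
    identity = solve-∀

  -- f(m+h) - f(m) = h (a (2m+h) + b) is a multiple of h.
  quadratic-periodic : ∀ m h → abs (f m) ≈[ h ] abs (f (m + + h))
  quadratic-periodic m h = ∣-antisym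
    (gcd-greatest
      (∣-combination (f m) (+ h) 1ℤ (a * (m + m + + h) + b)
        (gcd[m,n]∣m (abs (f m)) h) (gcd[m,n]∣n (abs (f m)) h) (forth a b c m (+ h)))
      (gcd[m,n]∣n (abs (f m)) h))
    (gcd-greatest
      (∣-combination (f (m + + h)) (+ h) 1ℤ (- (a * (m + m + + h) + b))
        (gcd[m,n]∣m (abs (f (m + + h))) h) (gcd[m,n]∣n (abs (f (m + + h))) h) (back a b c m (+ h)))
      (gcd[m,n]∣n (abs (f (m + + h))) h))
    where
    forth : ∀ a b c m h → a * ((m + h) * (m + h)) + b * (m + h) + c ≡
      1ℤ * (a * (m * m) + b * m + c) + (a * (m + m + h) + b) * h
    forth = solve-∀
    back : ∀ a b c m h → a * (m * m) + b * m + c ≡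
      1ℤ * (a * ((m + h) * (m + h)) + b * (m + h) + c) + - (a * (m + m + h) + b) * h
    back = solve-∀

  -- A root n ≥ 1 satisfies a n² = -(bn + c), so n² ≤ (|b| + |c|) n and n ≤ |b| + |c|.
  quadratic≢0 : .{{_ : NonZero (abs a)}} → ∀ n → abs b ℕ.+ abs c < n → f (+ n) ≢ 0ℤ
  quadratic≢0 n@(suc _) bound fn≡0 = contradiction
    (ℕ.*-cancelʳ-≤ n (abs b ℕ.+ abs c) n (let open ℕ.≤-Reasoning in begin
      n ℕ.* n                      ≤⟨ ℕ.m≤n*m (n ℕ.* n) (abs a) ⟩
      abs a ℕ.* (n ℕ.* n)          ≡⟨ cong (abs a ℕ.*_) (abs-* (+ n) (+ n)) ⟨
      abs a ℕ.* abs (+ n * + n)    ≡⟨ abs-* a (+ n * + n) ⟨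
      abs (a * (+ n * + n))        ≡⟨ cong abs an²≡ ⟩
      abs (- (b * + n + c))        ≡⟨ ∣-i∣≡∣i∣ (b * + n + c) ⟩
      abs (b * + n + c)            ≤⟨ ∣i+j∣≤∣i∣+∣j∣ (b * + n) c ⟩
      abs (b * + n) ℕ.+ abs c      ≤⟨ ℕ.+-mono-≤ (ℕ.≤-reflexive (abs-* b (+ n))) (ℕ.m≤m*n (abs c) n) ⟩
      abs b ℕ.* n ℕ.+ abs c ℕ.* n  ≡⟨ ℕ.*-distribʳ-+ n (abs b) (abs c) ⟨
      (abs b ℕ.+ abs c) ℕ.* n      ∎))
    (ℕ.<⇒≱ bound)
    where
    isolate : ∀ a b c n → a * (n * n) ≡ (a * (n * n) + b * n + c) - (b * n + c)
    isolate = solve-∀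
    an²≡ : a * (+ n * + n) ≡ - (b * + n + c)
    an²≡ = begin
      a * (+ n * + n)          ≡⟨ isolate a b c (+ n) ⟩
      f (+ n) - (b * + n + c)  ≡⟨ cong (_- (b * + n + c)) fn≡0 ⟩
      0ℤ - (b * + n + c)       ≡⟨ ℤ.+-identityˡ (- (b * + n + c)) ⟩
      - (b * + n + c)          ∎
      where open ≡-Reasoning

  ∈Domain : .{{_ : NonZero (abs a)}} → ∀ k n → abs b ℕ.+ abs c < n → n ∈ Domain k f
  ∈Domain k n bound = ℕ.≤-trans (s≤s z≤n) bound , λ where
    (_ , i , _ , f≡0) → quadratic≢0 (n ℕ.+ i) (ℕ.≤-trans bound (ℕ.m≤m+n n i)) f≡0

  -- The right side takes no proof of membership in the domain, so values at different arguments can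
  -- be compared directly.
  g≡redundancy : ∀ k n n∈D → g k f n n∈D ≡ redundancy (values k f n)
  g≡redundancy k n n∈D = product/lcms≡redundancy (values k f n)
    where instance _ = lcms-values≢0 k f n n∈D

  g≢0 : ∀ k n n∈D → NonZero (g k f n n∈D)
  g≢0 k n n∈D@(1≤n , n∉Z) = subst NonZero (sym (g≡redundancy k n n∈D))
    (redundancy≢0 (applyUpTo⁺₁ _ (suc k) λ {i} i≤k → ≢-nonZero λ fi≡0 →
      n∉Z (1≤n , i , ℕ.≤-pred i≤k , ∣i∣≡0⇒i≡0 fi≡0)))

  -- The period `B k a D`.

  private
    -- Repeats the entries of `B`, with i = `suc j`, so that `B k a D` unfolds to
    -- `lcms (applyUpTo term k)`.
    term : ℕ → ℕ
    term j = abs (+ suc j * (a * a * (+ suc j * + suc j) - D))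

  gcd-values∣B : ∀ k n {i j} → i < j → j < suc k →
                 gcd (abs (f (+ (n ℕ.+ i)))) (abs (f (+ (n ℕ.+ j)))) ∣ B k a D
  gcd-values∣B k n {i} {j} i<j j≤k with ℕ.m≤n⇒∃[o]m+o≡n i<j
  -- Here j = i + 1 + o: the shift is d = o + 1, whose entry in the lcm is `term o`, and o < k.
  ... | o , refl = ∣-trans
    (subst (λ m → gcd (abs (f (+ (n ℕ.+ i)))) (abs (f (+ m))) ∣ term o) (shift n i o)
      (gcd-values∣resultant (+ (n ℕ.+ i)) (+ suc o)))
    (∈⇒∣lcms (∈-applyUpTo⁺ term (ℕ.≤-trans (s≤s (ℕ.m≤n+m o i)) (ℕ.≤-pred j≤k))))
    where
    shift : ∀ n i o → n ℕ.+ i ℕ.+ suc o ≡ n ℕ.+ (suc i ℕ.+ o)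
    shift n i o = trans (ℕ.+-assoc n i (suc o)) (cong (n ℕ.+_) (ℕ.+-suc i o))

  -- The lcm divides the product of its entries, and for i ≥ 1 an entry vanishes only if D = a²i².
  B≢0 : ∀ k → (∀ i → 1ℤ ≤ᶻ i → i ≤ᶻ + k → D ≢ a * a * (i * i)) → NonZero (B k a D)
  B≢0 k D≢ = ≢-nonZero λ B≡0 →
    ℕ.≢-nonZero⁻¹ (product terms) {{product≢0 terms≢0}}
      (0∣⇒≡0 (subst (_∣ product terms) B≡0 (lcms∣product terms)))
    where
    terms = applyUpTo term k
    terms≢0 : All NonZero terms
    terms≢0 = applyUpTo⁺₁ term k λ {j} j<k → ≢-nonZero λ term≡0 →
      D≢ (+ suc j) (+≤+ (s≤s z≤n)) (+≤+ j<k)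
        -- `suc j ℕ.* x` unfolds to `x ℕ.+ j ℕ.* x`, so its vanishing forces x = 0.
        (sym (i-j≡0⇒i≡j (a * a * (+ suc j * + suc j)) D (∣i∣≡0⇒i≡0 (ℕ.m+n≡0⇒m≡0 _
          (trans (sym (abs-* (+ suc j) (a * a * (+ suc j * + suc j) - D))) term≡0)))))

  B-isPeriod : .{{_ : NonZero (abs a)}} → ∀ k → NonZero (B k a D) → IsPeriod k f (B k a D)
  -- From |b| + |c| + 1 on, no value f(n+i) is zero.
  B-isPeriod k B≢0 = ℕ.>-nonZero⁻¹ β {{B≢0}} , suc (abs b ℕ.+ abs c) , s≤s z≤n , λ n bound →
    let n∈D   = ∈Domain k n bound
        n+β∈D = ∈Domain k (n ℕ.+ β) (ℕ.≤-trans bound (ℕ.m≤m+n n β))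
    in n∈D , n+β∈D , trans (g≡redundancy k (n ℕ.+ β) n+β∈D)
                       (trans (sym (redundancy-periodic n)) (sym (g≡redundancy k n n∈D)))
    where
    β = B k a D
    x : ℕ → ℕ → ℕ
    x n i = abs (f (+ (n ℕ.+ i)))
    swap : ∀ n i h → n ℕ.+ i ℕ.+ h ≡ n ℕ.+ h ℕ.+ i
    swap = ℕ.solve-∀
    values-periodic : ∀ n i → x n i ≈[ β ] x (n ℕ.+ β) i
    values-periodic n i =
      subst (λ m → x n i ≈[ β ] abs (f (+ m))) (swap n i β) (quadratic-periodic (+ (n ℕ.+ i)) β)
    redundancy-periodic : ∀ n → redundancy (values k f n) ≡ redundancy (values k f (n ℕ.+ β))
    redundancy-periodic n = redundancy-cong β
      (Pointwise-applyUpTo⁺ (x n) (x (n ℕ.+ β)) (suc k) (values-periodic n))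
      (AllPairs-applyUpTo⁺ (x n) (suc k) (gcd-values∣B k n))
      (AllPairs-applyUpTo⁺ (x (n ℕ.+ β)) (suc k) (gcd-values∣B k (n ℕ.+ β)))

  -- Unboundedness of g when D = a²i².

  linearFactor∣4a·gcd : ∀ m i → D ≡ a * a * (i * i) →
    abs (+ 2 * a * m + b + a * i) ∣ abs (+ 4 * a) ℕ.* gcd (abs (f m)) (abs (f (m + i)))
  linearFactor∣4a·gcd m i D≡ =
    subst (abs v ∣_) (sym (c*gcd[m,n]≡gcd[cm,cn] (abs (+ 4 * a)) (abs (f m)) (abs (f (m + i)))))
      (gcd-greatest
        (subst (abs v ∣_) (abs-* (+ 4 * a) (f m))
          (∣-combination v Δ (+ 2 * a * m + b - a * i) (- 1ℤ) ∣-refl v∣Δ (factor₀ a b c m i)))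
        (subst (abs v ∣_) (abs-* (+ 4 * a) (f (m + i)))
          (∣-combination v Δ (+ 2 * a * m + b + + 3 * a * i) (- 1ℤ) ∣-refl v∣Δ (factor₁ a b c m i))))
    where
    v = + 2 * a * m + b + a * i
    -- The factorisations are polynomial identities only up to Δ, which the hypothesis makes zero
    -- and hence divisible by `v`.
    Δ = D - a * a * (i * i)
    v∣Δ : abs v ∣ abs Δ
    v∣Δ = subst (λ z → abs v ∣ abs z) (sym (ℤ.i≡j⇒i-j≡0 D≡)) (abs v ∣0)
    factor₀ : ∀ a b c m i → + 4 * a * (a * (m * m) + b * m + c) ≡
      (+ 2 * a * m + b - a * i) * (+ 2 * a * m + b + a * i)
      + - 1ℤ * ((b * b - + 4 * a * c) - a * a * (i * i))
    factor₀ = solve-∀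
    factor₁ : ∀ a b c m i → + 4 * a * (a * ((m + i) * (m + i)) + b * (m + i) + c) ≡
      (+ 2 * a * m + b + + 3 * a * i) * (+ 2 * a * m + b + a * i)
      + - 1ℤ * ((b * b - + 4 * a * c) - a * a * (i * i))
    factor₁ = solve-∀

  -- v - b = a (2n + j) has absolute value at least n; |b| is added on the right because v itself
  -- may be small.
  n≤linearFactor : .{{_ : NonZero (abs a)}} → ∀ n j →
    n ≤ abs (+ 2 * a * + n + b + a * + j) ℕ.+ abs b
  n≤linearFactor n j = begin
    n                                  ≤⟨ ℕ.m≤m+n n (n ℕ.+ j) ⟩
    n ℕ.+ (n ℕ.+ j)                    ≤⟨ ℕ.m≤n*m _ (abs a) ⟩
    abs a ℕ.* abs (+ n + (+ n + + j))  ≡⟨ abs-* a (+ n + (+ n + + j)) ⟨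
    abs (a * (+ n + (+ n + + j)))      ≡⟨ cong abs (isolate a b (+ n) (+ j)) ⟩
    abs (v - b)                        ≤⟨ ∣i-j∣≤∣i∣+∣j∣ v b ⟩
    abs v ℕ.+ abs b                    ∎
    where
    open ℕ.≤-Reasoning
    v = + 2 * a * + n + b + a * + j
    isolate : ∀ a b n j → a * (n + (n + j)) ≡ (+ 2 * a * n + b + a * j) - b
    isolate = solve-∀

  -- With i = `suc j`, the linear factor divides 4a gcd (f(n), f(n+i)), hence 4a g(n); as this is
  -- nonzero, divisibility becomes an inequality.
  n≤4a·g : .{{_ : NonZero (abs a)}} → ∀ k j → j < k → D ≡ a * a * (+ suc j * + suc j) →
           ∀ n n∈D → n ≤ abs (+ 4 * a) ℕ.* g k f n n∈D ℕ.+ abs b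
  n≤4a·g k j j<k D≡ n n∈D = ℕ.≤-trans (n≤linearFactor n (suc j))
    (ℕ.+-monoˡ-≤ (abs b) (∣⇒≤ {{4ag≢0}} (∣-trans (linearFactor∣4a·gcd (+ n) (+ suc j) D≡)
      (*-monoʳ-∣ (abs (+ 4 * a)) gcd∣g))))
    where
    x : ℕ → ℕ
    x i = abs (f (+ (n ℕ.+ i)))
    gcd∣g : gcd (abs (f (+ n))) (x (suc j)) ∣ g k f n n∈D
    gcd∣g = subst₂ _∣_ (cong (λ m → gcd (abs (f (+ m))) (x (suc j))) (ℕ.+-identityʳ n))
      (sym (g≡redundancy k n n∈D)) (gcd∣redundancy (x 0) (∈-applyUpTo⁺ (x ∘ suc) j<k))
    4ag≢0 : NonZero (abs (+ 4 * a) ℕ.* g k f n n∈D)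
    4ag≢0 = ℕ.m*n≢0 (abs (+ 4 * a)) (g k f n n∈D)
      {{subst NonZero (sym (abs-* (+ 4) a)) (ℕ.m*n≢0 4 (abs a))}} {{g≢0 k n n∈D}}

  -- Periodicity makes g constant along n₀, n₀ + t, n₀ + 2t, ..., against the linear lower bound
  -- `n≤4a·g`.
  eventuallyPeriodic⇒D≢ : .{{_ : NonZero (abs a)}} → ∀ k → EventuallyPeriodic k f →
    ∀ i → 1ℤ ≤ᶻ i → i ≤ᶻ + k → D ≢ a * a * (i * i)
  eventuallyPeriodic⇒D≢ k (t , 1≤t , n₀ , _ , periodic) (+ suc j) (+≤+ _) (+≤+ j<k) D≡ =
    ℕ.<⇒≱ s≤n (begin
      n                                        ≤⟨ n≤4a·g k j j<k D≡ n n∈D ⟩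
      abs (+ 4 * a) ℕ.* g k f n n∈D ℕ.+ abs b  ≡⟨ cong (λ x → abs (+ 4 * a) ℕ.* x ℕ.+ abs b) gn≡ ⟩
      abs (+ 4 * a) ℕ.* r n₀ ℕ.+ abs b         ∎)
    where
    open ℕ.≤-Reasoning
    r : ℕ → ℕ
    r n = redundancy (values k f n)
    r-periodic : ∀ n → n₀ ≤ n → r (n ℕ.+ t) ≡ r n
    r-periodic n n₀≤n with periodic n n₀≤n
    ... | n∈D , n+t∈D , g≡ = trans (sym (g≡redundancy k _ n+t∈D)) (trans g≡ (g≡redundancy k n n∈D))
    constant : ∀ s → r (n₀ ℕ.+ s ℕ.* t) ≡ r n₀
    constant zero    = cong r (ℕ.+-identityʳ n₀)
    constant (suc s) = trans
      (cong r (step n₀ t (s ℕ.* t)))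
      (trans (r-periodic _ (ℕ.m≤m+n n₀ _)) (constant s))
      where
      step : ∀ n t u → n ℕ.+ (t ℕ.+ u) ≡ n ℕ.+ u ℕ.+ t
      step = ℕ.solve-∀
    -- One more than the upper bound on n; since t ≥ 1, n ≥ s exceeds it.
    s = suc (abs (+ 4 * a) ℕ.* r n₀ ℕ.+ abs b)
    n = n₀ ℕ.+ s ℕ.* t
    n∈D = proj₁ (periodic n (ℕ.m≤m+n n₀ _))
    gn≡ : g k f n n∈D ≡ r n₀
    gn≡ = trans (g≡redundancy k n n∈D) (constant s)
    s≤n : s ≤ n
    s≤n = ℕ.≤-trans (ℕ.m≤m*n s t {{ℕ.>-nonZero 1≤t}}) (ℕ.m≤n+m (s ℕ.* t) n₀)

theorem2p1 :
    (a b c : ℤ) → 1ℤ ≤ᶻ a → Primitive a b c →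
    (k : ℕ) → 1 ≤ k →
    let f = quadratic a b c
        D = discriminant a b c
    in
    (EventuallyPeriodic k f ⇔
      ((i : ℤ) → 1ℤ ≤ᶻ i → i ≤ᶻ + k → D ≢ a * a * (i * i)))
    × (EventuallyPeriodic k f → IsPeriod k f (B k a D))
-- Matching `a` as `+ suc _` makes the instance `NonZero (abs a)` available.
theorem2p1 a@(+ suc _) b c (+≤+ _) _ k _ =
  mk⇔ (eventuallyPeriodic⇒D≢ a b c k) (λ D≢ → B k a D , D≢⇒B-isPeriod D≢) ,
  D≢⇒B-isPeriod ∘ eventuallyPeriodic⇒D≢ a b c k
  where
  D = discriminant a b c
  D≢⇒B-isPeriod : (∀ i → 1ℤ ≤ᶻ i → i ≤ᶻ + k → D ≢ a * a * (i * i)) →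
                  IsPeriod k (quadratic a b c) (B k a D)
  D≢⇒B-isPeriod D≢ = B-isPeriod a b c k (B≢0 a b c k D≢)
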